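{- Let $t=[1\ 0\ 0\ 0\ 0\ 0\ 0\ 0]$ (row vector), $u=[1\ 1\ 1\ 1\ 1\ 2\ 1\ 4]^T$ (column vector), and \[\gamma(0)=\begin{bmatrix} 0&1&0&0&0&0&0&0\\ 0&0&0&1&0&0&0&0\\ -1&1&0&1&0&0&0&0\\ 0&0&0&0&1&0&0&0\\ 0&0&0&0&0&0&1&0\\ -1&0&0&2&1&0&0&0\\ 1&-1&0&-3&3&0&1&0\\ -1&-1&0&2&3&0&1&0 \end{bmatrix},\quad \gamma(1)=\begin{bmatrix} 0&0&1&0&0&0&0&0\\ 0&0&1&0&0&0&0&0\\ 0&0&0&0&0&0&0&0\\ 0&0&0&0&0&1&0&0\\ 0&0&0&0&0&1&0&0\\ 0&0&0&0&0&0&0&0\\ 0&0&0&0&0&0&0&1\\ 0&0&0&0&0&0&0&0 \end{bmatrix},\] extended to a monoid morphism $\gamma:\{0,1\}^*\to\mathbb{Z}^{8\times 8}$ by $\gamma(w_1w_2\cdots w_m)=\gamma(w_1)\gamma(w_2)\cdots\gamma(w_m)$. Then for every $n\geq 0$, if $z=z_1\cdots z_m$ is the canonical Fibonacci representation of $n$ and $z^R=z_m\cdots z_1$ is its reversal, we have $t\,\gamma(z^R)\,u=V(n)$. In particular, $V$ is Fibonacci-regular.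
   Context: Fibonacci numbers: $F_0=0$, $F_1=1$, $F_{m+2}=F_{m+1}+F_m$. For a word $k_m\cdots k_0$ of nonnegative integer digits, $[k_m\cdots k_0]_F=\sum_{i=0}^m k_iF_{i+2}$. The canonical Fibonacci representation of $n\geq 0$ is the unique binary word $z$ with no leading zero and no two consecutive $1$s such that $[z]_F=n$ (the empty word for $n=0$). Standard Fibonacci words: $f_{ -1}=b$, $f_0=a$, $f_{m+1}=f_mf_{m-1}$. The Fibonacci word ${\bf f}=\lim f_m$, with prefix of length $j$ denoted ${\bf f}(0..j]$. $V(N)$ is the number of factorizations of ${\bf f}(0..N]$ as $f_m^{k_m}\cdots f_0^{k_0}$ with all $k_i\geq 0$ (into standard words $f_i$, $i\geq0$, in non-strictly decreasing order of index), counted up to leading zero exponents; $V(0)=1$. A sequence $s$ is Fibonacci-regular if there are a row vector $v$, a column vector $w$ and a matrix-valued morphism $\rho$ on $\{0,1\}^*$ with $s([z]_F)=v\rho(z)w$ for all canonical representations $z$. -}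

module Defs where

open import Data.Fin using (Fin; zero; suc; toℕ)
import Data.Fin.Properties as Fin
open import Data.Integer using (ℤ; +_; 0ℤ; 1ℤ; -1ℤ) renaming (_*_ to _*ℤ_; -_ to -ℤ_)
open import Data.Integer.Properties using () renaming (+-*-semiring to ℤ-semiring)
open import Data.List using (List; []; _∷_; _++_; length; map; concat; replicate; take; filter; lookup; upTo; cartesianProductWith)
open import Data.List.Membership.Propositional using (_∈_)
open import Data.List.Membership.Propositional.Properties using (∈-cartesianProductWith⁺; ∈-cartesianProductWith⁻; ∈-upTo⁺; ∈-filter⁺; ∈-filter⁻; ∈-lookup)
import Data.List.Properties as List
open import Data.List.Relation.Unary.All as All using (All; []; _∷_)
open import Data.List.Relation.Unary.AllPairs using ([]; _∷_)
open import Data.List.Relation.Unary.Any as Any using (here; there)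
open import Data.List.Relation.Unary.Any.Properties using (lookup-index)
open import Data.List.Relation.Unary.Linked using (Linked)
open import Data.List.Relation.Unary.Unique.Propositional using (Unique)
import Data.List.Relation.Unary.Unique.Propositional.Properties as Unique
open import Data.Nat using (ℕ; zero; suc; _+_; _*_; _≤_; z≤n; s≤s; NonZero)
open import Data.Nat.Properties as ℕ using (module ≤-Reasoning)
open import Data.Product using (_×_; _,_; proj₁; proj₂; Σ-syntax; ∃-syntax)
open import Data.Unit using (⊤; tt)
open import Data.Vec using (Vec; []; _∷_) renaming (lookup to lookupᵛ)
open import Data.Vec.Functional using (Vector)
open import Function using (_↔_; mk↔ₛ′; _∘_)
open import Relation.Binary.Definitions using (DecidableEquality)
open import Relation.Binary.PropositionalEquality using (_≡_; refl; sym; trans; cong; cong₂; subst)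
open import Relation.Nullary using (¬_; yes; no; contradiction; _×-dec_)
open import Relation.Unary using (Decidable)
open import Axiom.UniquenessOfIdentityProofs using (module Decidable⇒UIP)

F : ℕ → ℕ
F zero          = 0
F (suc zero)    = 1
F (suc (suc m)) = F (suc m) + F m

-- Words over ℕ are written most significant digit first: k_m ∷ … ∷ k_0 ∷ [].
[_]F : List ℕ → ℕ
[ [] ]F     = 0
[ k ∷ ks ]F = k * F (length ks + 2) + [ ks ]F

NoLeadingZero : List ℕ → Set
NoLeadingZero []      = ⊤
NoLeadingZero (k ∷ _) = NonZero k

Bit : Set
Bit = Fin 2

digits : List Bit → List ℕ
digits = map toℕ

record IsCanonical (n : ℕ) (z : List Bit) : Set where
  field
    noLeadingZero   : NoLeadingZero (digits z)
    noConsecutive1s : Linked (λ x y → ¬ (x ≡ 1 × y ≡ 1)) (digits z)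
    value           : [ digits z ]F ≡ n

data Letter : Set where
  a b : Letter

_≟ᴸ_ : DecidableEquality Letter
a ≟ᴸ a = yes refl
a ≟ᴸ b = no λ ()
b ≟ᴸ a = no λ ()
b ≟ᴸ b = yes refl

Word : Set
Word = List Letter

f₋₁ : Word
f₋₁ = b ∷ []

f : ℕ → Word
f zero          = a ∷ []
f (suc zero)    = f zero ++ f₋₁
f (suc (suc m)) = f (suc m) ++ f m

-- The prefix of length N of the infinite Fibonacci word lim f_m. It can be read
-- off f_N, which has at least N letters; see length-prefix and prefix-of-f.
prefix : ℕ → Word
prefix N = take N (f N)

-- k_m ∷ … ∷ k_0 ∷ [] stands for the product f_m^{k_m} ⋯ f_0^{k_0}.
expand : List ℕ → Word
expand []       = []
expand (k ∷ ks) = concat (replicate k (f (length ks))) ++ expand ks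

-- Each class of factorizations up to leading zero exponents is represented by
-- its unique member without leading zero exponents.
IsFactorization : ℕ → List ℕ → Set
IsFactorization N ks = NoLeadingZero ks × expand ks ≡ prefix N

Factorization : ℕ → Set
Factorization N = ∃[ ks ] IsFactorization N ks

noLeadingZero? : Decidable NoLeadingZero
noLeadingZero? []      = yes tt
noLeadingZero? (k ∷ _) = ℕ.nonZero? k

isFactorization? : ∀ N → Decidable (IsFactorization N)
isFactorization? N ks = noLeadingZero? ks ×-dec List.≡-dec _≟ᴸ_ (expand ks) (prefix N)

-- All words of length at most l over the digits 0, …, B.
wordsUpTo : ℕ → ℕ → List (List ℕ)
wordsUpTo B zero    = [] ∷ []
wordsUpTo B (suc l) = [] ∷ cartesianProductWith _∷_ (upTo (suc B)) (wordsUpTo B l)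

-- The bounds on length and digits lose no factorization: V N is the cardinality
-- of Factorization N, by V-counts.
V : ℕ → ℕ
V N = length (filter (isFactorization? N) (wordsUpTo N N))

open import Algebra.Properties.Semiring.Sum ℤ-semiring using (sum-syntax)

Matrix : ℕ → ℕ → Set
Matrix m n = Fin m → Fin n → ℤ

identity : ∀ {n} → Matrix n n
identity i j with i Fin.≟ j
... | yes _ = 1ℤ
... | no  _ = 0ℤ

infixl 7 _·_

_·_ : ∀ {l m n} → Matrix l m → Matrix m n → Matrix l n
_·_ {m = m} A B i k = ∑[ j < m ] (A i j *ℤ B j k)

-- The 1 × 1 product of a row vector, a matrix and a column vector, as a scalar.
_⟨_⟩_ : ∀ {m n} → Vector ℤ m → Matrix m n → Vector ℤ n → ℤ
_⟨_⟩_ {m} {n} v M w = ∑[ j < n ] ((∑[ i < m ] (v i *ℤ M i j)) *ℤ w j)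

-- The extension of a map on letters to a monoid morphism; {0,1}^* being free,
-- every matrix-valued morphism arises this way.
morphism : ∀ {d} → (Bit → Matrix d d) → List Bit → Matrix d d
morphism ρ []      = identity
morphism ρ (x ∷ z) = ρ x · morphism ρ z

FibonacciRegular : (ℕ → ℤ) → Set
FibonacciRegular s =
  Σ[ d ∈ ℕ ] Σ[ v ∈ Vector ℤ d ] Σ[ ρ ∈ (Bit → Matrix d d) ] Σ[ w ∈ Vector ℤ d ]
    (∀ n z → IsCanonical n z → s n ≡ v ⟨ morphism ρ z ⟩ w)

private
  2ℤ 3ℤ 4ℤ -3ℤ : ℤ
  2ℤ  = + 2
  3ℤ  = + 3
  4ℤ  = + 4
  -3ℤ = -ℤ (+ 3)

  fromRows : ∀ {m n} → Vec (Vec ℤ n) m → Matrix m n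
  fromRows rows i j = lookupᵛ (lookupᵛ rows i) j

t : Vector ℤ 8
t = lookupᵛ (1ℤ ∷ 0ℤ ∷ 0ℤ ∷ 0ℤ ∷ 0ℤ ∷ 0ℤ ∷ 0ℤ ∷ 0ℤ ∷ [])

u : Vector ℤ 8
u = lookupᵛ (1ℤ ∷ 1ℤ ∷ 1ℤ ∷ 1ℤ ∷ 1ℤ ∷ 2ℤ ∷ 1ℤ ∷ 4ℤ ∷ [])

γ-letter : Bit → Matrix 8 8
γ-letter zero = fromRows
  ( ( 0ℤ ∷  1ℤ ∷  0ℤ ∷  0ℤ ∷  0ℤ ∷  0ℤ ∷  0ℤ ∷  0ℤ ∷ [])
  ∷ ( 0ℤ ∷  0ℤ ∷  0ℤ ∷  1ℤ ∷  0ℤ ∷  0ℤ ∷  0ℤ ∷  0ℤ ∷ [])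
  ∷ (-1ℤ ∷  1ℤ ∷  0ℤ ∷  1ℤ ∷  0ℤ ∷  0ℤ ∷  0ℤ ∷  0ℤ ∷ [])
  ∷ ( 0ℤ ∷  0ℤ ∷  0ℤ ∷  0ℤ ∷  1ℤ ∷  0ℤ ∷  0ℤ ∷  0ℤ ∷ [])
  ∷ ( 0ℤ ∷  0ℤ ∷  0ℤ ∷  0ℤ ∷  0ℤ ∷  0ℤ ∷  1ℤ ∷  0ℤ ∷ [])
  ∷ (-1ℤ ∷  0ℤ ∷  0ℤ ∷  2ℤ ∷  1ℤ ∷  0ℤ ∷  0ℤ ∷  0ℤ ∷ [])
  ∷ ( 1ℤ ∷ -1ℤ ∷  0ℤ ∷ -3ℤ ∷  3ℤ ∷  0ℤ ∷  1ℤ ∷  0ℤ ∷ [])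
  ∷ (-1ℤ ∷ -1ℤ ∷  0ℤ ∷  2ℤ ∷  3ℤ ∷  0ℤ ∷  1ℤ ∷  0ℤ ∷ [])
  ∷ [] )
γ-letter (suc zero) = fromRows
  ( ( 0ℤ ∷  0ℤ ∷  1ℤ ∷  0ℤ ∷  0ℤ ∷  0ℤ ∷  0ℤ ∷  0ℤ ∷ [])
  ∷ ( 0ℤ ∷  0ℤ ∷  1ℤ ∷  0ℤ ∷  0ℤ ∷  0ℤ ∷  0ℤ ∷  0ℤ ∷ [])
  ∷ ( 0ℤ ∷  0ℤ ∷  0ℤ ∷  0ℤ ∷  0ℤ ∷  0ℤ ∷  0ℤ ∷  0ℤ ∷ [])
  ∷ ( 0ℤ ∷  0ℤ ∷  0ℤ ∷  0ℤ ∷  0ℤ ∷  1ℤ ∷  0ℤ ∷  0ℤ ∷ [])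
  ∷ ( 0ℤ ∷  0ℤ ∷  0ℤ ∷  0ℤ ∷  0ℤ ∷  1ℤ ∷  0ℤ ∷  0ℤ ∷ [])
  ∷ ( 0ℤ ∷  0ℤ ∷  0ℤ ∷  0ℤ ∷  0ℤ ∷  0ℤ ∷  0ℤ ∷  0ℤ ∷ [])
  ∷ ( 0ℤ ∷  0ℤ ∷  0ℤ ∷  0ℤ ∷  0ℤ ∷  0ℤ ∷  0ℤ ∷  1ℤ ∷ [])
  ∷ ( 0ℤ ∷  0ℤ ∷  0ℤ ∷  0ℤ ∷  0ℤ ∷  0ℤ ∷  0ℤ ∷  0ℤ ∷ [])
  ∷ [] )

γ : List Bit → Matrix 8 8
γ = morphism γ-letter

length-f : ∀ m → suc m ≤ length (f m)
length-f zero          = s≤s z≤n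
length-f (suc zero)    = s≤s (s≤s z≤n)
length-f (suc (suc m)) = begin
  suc (suc (suc m))                 ≡⟨ ℕ.+-comm 1 (suc (suc m)) ⟩
  suc (suc m) + 1                   ≤⟨ ℕ.+-mono-≤ (length-f (suc m)) (ℕ.≤-trans (s≤s z≤n) (length-f m)) ⟩
  length (f (suc m)) + length (f m) ≡⟨ List.length-++ (f (suc m)) ⟨
  length (f (suc m) ++ f m)         ∎
  where open ≤-Reasoning

length-prefix : ∀ N → length (prefix N) ≡ N
length-prefix N = trans (List.length-take N (f N)) (ℕ.m≤n⇒m⊓n≡m (ℕ.<⇒≤ (length-f N)))

private
  take-++ˡ : ∀ N (x y : Word) → N ≤ length x → take N (x ++ y) ≡ take N x
  take-++ˡ zero    x       y _       = refl
  take-++ˡ (suc N) (l ∷ x) y (s≤s p) = cong (l ∷_) (take-++ˡ N x y p)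

  take-f-step : ∀ N m → N ≤ length (f m) → take N (f (suc m)) ≡ take N (f m)
  take-f-step N zero    p = take-++ˡ N (f 0) f₋₁ p
  take-f-step N (suc m) p = take-++ˡ N (f (suc m)) (f m) p

  length-f-step : ∀ m → length (f m) ≤ length (f (suc m))
  length-f-step zero    = s≤s z≤n
  length-f-step (suc m) = subst (length (f (suc m)) ≤_) (sym (List.length-++ (f (suc m)))) (ℕ.m≤m+n _ _)

  take-f-+ : ∀ N m d → N ≤ length (f m) → take N (f (d + m)) ≡ take N (f m)
  take-f-+ N m zero    p = refl
  take-f-+ N m (suc d) p = trans (take-f-step N (d + m) (grow d)) (take-f-+ N m d p)
    where
    grow : ∀ e → N ≤ length (f (e + m))
    grow zero    = p
    grow (suc e) = ℕ.≤-trans (grow e) (length-f-step (e + m))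

prefix-of-f : ∀ N m → N ≤ length (f m) → take N (f m) ≡ prefix N
prefix-of-f N m p = trans (sym (take-f-+ N m N p))
  (trans (cong (take N ∘ f) (ℕ.+-comm N m)) (take-f-+ N N m (ℕ.<⇒≤ (length-f N))))

private
  length-power : ∀ k (x : Word) → length (concat (replicate k x)) ≡ k * length x
  length-power zero    x = refl
  length-power (suc k) x = trans (List.length-++ x) (cong (λ l → length x + l) (length-power k x))

  length-expand : ∀ k ks → length (expand (k ∷ ks)) ≡ k * length (f (length ks)) + length (expand ks)
  length-expand k ks = trans (List.length-++ (concat (replicate k (f (length ks)))))
    (cong (_+ length (expand ks)) (length-power k (f (length ks))))

  digit-bound : ∀ ks → All (_≤ length (expand ks)) ks
  digit-bound []       = []
  digit-bound (k ∷ ks) rewrite length-expand k ks =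
    ℕ.≤-trans (ℕ.≤-trans (ℕ.≤-reflexive (sym (ℕ.*-identityʳ k)))
                         (ℕ.*-monoʳ-≤ k (ℕ.≤-trans (s≤s z≤n) (length-f (length ks)))))
              (ℕ.m≤m+n _ _)
    ∷ All.map (λ p → ℕ.≤-trans p (ℕ.m≤n+m _ _)) (digit-bound ks)

  length-bound : ∀ ks → NoLeadingZero ks → length ks ≤ length (expand ks)
  length-bound []           _ = z≤n
  length-bound (suc k ∷ ks) _ rewrite length-expand (suc k) ks =
    ℕ.≤-trans (length-f (length ks)) (ℕ.≤-trans (ℕ.m≤m+n _ _) (ℕ.m≤m+n _ _))

  ∈-wordsUpTo : ∀ B l ks → length ks ≤ l → All (_≤ B) ks → ks ∈ wordsUpTo B l
  ∈-wordsUpTo B zero    []       _       _        = here refl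
  ∈-wordsUpTo B (suc l) []       _       _        = here refl
  ∈-wordsUpTo B (suc l) (k ∷ ks) (s≤s p) (q ∷ qs) =
    there (∈-cartesianProductWith⁺ _∷_ (∈-upTo⁺ (s≤s q)) (∈-wordsUpTo B l ks p qs))

  wordsUpTo-unique : ∀ B l → Unique (wordsUpTo B l)
  wordsUpTo-unique B zero    = [] ∷ []
  wordsUpTo-unique B (suc l) =
    All.tabulate (λ { i refl → []∉ (upTo (suc B)) i }) ∷
    Unique.cartesianProductWith⁺ cons List.∷-injective (Unique.upTo⁺ (suc B)) (wordsUpTo-unique B l)
    where
    cons : ℕ → List ℕ → List ℕ
    cons = _∷_
    []∉ : ∀ ks {kss} → ¬ (_∈_ {A = List ℕ} [] (cartesianProductWith cons ks kss))
    []∉ ks {kss} i with ∈-cartesianProductWith⁻ cons ks kss i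
    ... | _ , _ , _ , _ , ()

  candidate : ∀ {N} (φ : Factorization N) → proj₁ φ ∈ wordsUpTo N N
  candidate {N} (ks , nz , eq) = ∈-wordsUpTo N N ks
    (subst (length ks ≤_) len (length-bound ks nz))
    (subst (λ B → All (_≤ B) ks) len (digit-bound ks))
    where
    len : length (expand ks) ≡ N
    len = trans (cong length eq) (length-prefix N)

  noLeadingZero-irrelevant : ∀ ks (p q : NoLeadingZero ks) → p ≡ q
  noLeadingZero-irrelevant []           _ _ = refl
  noLeadingZero-irrelevant (suc k ∷ ks) _ _ = refl

  factorization-≡ : ∀ {N} {φ ψ : Factorization N} → proj₁ φ ≡ proj₁ ψ → φ ≡ ψ
  factorization-≡ {φ = ks , p , q} {ψ = _ , p′ , q′} refl =
    cong (ks ,_) (cong₂ _,_ (noLeadingZero-irrelevant ks p p′)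
                            (Decidable⇒UIP.≡-irrelevant (List.≡-dec _≟ᴸ_) q q′))

  lookup-injective : ∀ {A : Set} {xs : List A} → Unique xs → ∀ i j → lookup xs i ≡ lookup xs j → i ≡ j
  lookup-injective (_ ∷ _) zero    zero    _ = refl
  lookup-injective {xs = _ ∷ xs} (x∉ ∷ _) zero    (suc j) e = contradiction e (All.lookup x∉ (∈-lookup {xs = xs} j))
  lookup-injective {xs = _ ∷ xs} (x∉ ∷ _) (suc i) zero    e = contradiction (sym e) (All.lookup x∉ (∈-lookup {xs = xs} i))
  lookup-injective (_ ∷ us) (suc i) (suc j) e = cong suc (lookup-injective us i j e)

V-counts : ∀ N → Fin (V N) ↔ Factorization N
V-counts N = mk↔ₛ′ to from
  (λ φ → factorization-≡ (sym (lookup-index (member φ))))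
  (λ i → lookup-injective unique _ _ (sym (lookup-index (member (to i)))))
  where
  factorizations : List (List ℕ)
  factorizations = filter (isFactorization? N) (wordsUpTo N N)

  unique : Unique factorizations
  unique = Unique.filter⁺ (isFactorization? N) (wordsUpTo-unique N N)

  member : (φ : Factorization N) → proj₁ φ ∈ factorizations
  member φ = ∈-filter⁺ (isFactorization? N) (candidate φ) (proj₂ φ)

  to : Fin (V N) → Factorization N
  to i = lookup factorizations i ,
    proj₂ (∈-filter⁻ (isFactorization? N) {xs = wordsUpTo N N} (∈-lookup {xs = factorizations} i))

  from : Factorization N → Fin (V N)
  from φ = Any.index (member φ)

{-# OPTIONS --safe #-}
module Submission where

-- Let φ be the morphism a ↦ ab, b ↦ a. Since φ(f_m) = f_{m+1} and f_0 = a, appending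
-- an exponent k to a factorization of x gives one of φ(x)a^k, and every factorization
-- arises so. Because φ(b) = a and no product of the f_m contains bb, the number C of
-- factorizations of a word satisfies C(φ(x)) = C(x) if x ends in a, and
-- C(φ(x)a^{j+1}) = C(x) + C(xb) if x does not end in b. The prefix of length [z]_F is
-- obtained by reading z, a digit d acting as x ↦ φ(x)a^d, so these rules give a linear
-- recursion. It closes on the three numbers C(xa), C(φ(x)a), C(φ²(x)a), and the eight
-- coordinates of γ(z^R)u are fixed linear combinations of them.

open import Defs
open import Axiom.UniquenessOfIdentityProofs using (module Decidable⇒UIP)
open import Data.Fin using (Fin; zero; suc; toℕ)
import Data.Fin.Permutation as Permutation
import Data.Fin.Properties as Fin
open import Data.Integer as ℤ using (ℤ; +_; 0ℤ; 1ℤ)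
import Data.Integer.Properties as ℤ
open import Data.Integer.Tactic.RingSolver using (solve-∀)
open import Algebra.Properties.Semiring.Sum ℤ.+-*-semiring
  using (sum-syntax; sum-cong-≗; ∑-comm; sum-replicate-zero; *-distribˡ-sum; *-distribʳ-sum)
open import Data.List using (List; []; _∷_; _++_; _∷ʳ_; concat; length; replicate; reverse; _ʳ++_; take; initLast; _∷ʳ′_)
import Data.List.Properties as List
open import Data.List.Relation.Unary.Linked using (Linked; _∷_; tail)
open import Data.Nat using (ℕ; zero; suc; _+_; _*_; _≤_)
import Data.Nat.Properties as ℕ
open import Data.Product using (_×_; _,_; proj₁; proj₂; ∃-syntax)
open import Data.Sum using (_⊎_; inj₁; inj₂)
open import Data.Sum.Function.Propositional using (_⊎-↔_)
open import Data.Unit using (tt)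
open import Data.Vec as Vec using (Vec; []; _∷_)
open import Data.Vec.Functional using (Vector) renaming ([] to []ᵛ; _∷_ to _∷ᵛ_)
open import Function using (_↔_; mk↔ₛ′; mk⤖; _∘_)
open import Function.Construct.Composition using (_↔-∘_)
open import Function.Construct.Symmetry using (↔-sym)
open import Function.Properties.Bijection using (⤖⇒↔)
open import Relation.Binary.PropositionalEquality using (_≡_; _≢_; _≗_; refl; sym; trans; cong; cong₂; subst; module ≡-Reasoning)
open import Relation.Nullary using (¬_; Dec; yes; no; contradiction; from-yes)

-- The morphism φ and the appending of an exponent.

φ : Word → Word
φ []      = []
φ (a ∷ x) = a ∷ b ∷ φ x
φ (b ∷ x) = a ∷ φ x

φ-++ : ∀ x y → φ (x ++ y) ≡ φ x ++ φ y
φ-++ []      y = refl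
φ-++ (a ∷ x) y = cong (λ w → a ∷ b ∷ w) (φ-++ x y)
φ-++ (b ∷ x) y = cong (a ∷_) (φ-++ x y)

φ-f : ∀ m → φ (f m) ≡ f (suc m)
φ-f zero          = refl
φ-f (suc zero)    = refl
φ-f (suc (suc m)) = trans (φ-++ (f (suc m)) (f m)) (cong₂ _++_ (φ-f (suc m)) (φ-f m))

as : ℕ → Word
as k = replicate k a

bs : ℕ → Word
bs k = replicate k b

expand-digit : ∀ k → expand (k ∷ []) ≡ as k
expand-digit zero    = refl
expand-digit (suc k) = cong (a ∷_) (expand-digit k)

φ-power : ∀ k m → φ (concat (replicate k (f m))) ≡ concat (replicate k (f (suc m)))
φ-power zero    m = refl
φ-power (suc k) m = trans (φ-++ (f m) _) (cong₂ _++_ (φ-f m) (φ-power k m))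

-- Appending k raises the index of every earlier factor by one, which is what φ does to f_m.
expand-∷ʳ : ∀ ks k → expand (ks ∷ʳ k) ≡ φ (expand ks) ++ as k
expand-∷ʳ []       k = expand-digit k
expand-∷ʳ (l ∷ ks) k = begin
  concat (replicate l (f (length (ks ∷ʳ k)))) ++ expand (ks ∷ʳ k)
    ≡⟨ cong₂ (λ m w → concat (replicate l (f m)) ++ w) (List.length-++-comm ks (k ∷ [])) (expand-∷ʳ ks k) ⟩
  concat (replicate l (f (suc (length ks)))) ++ φ (expand ks) ++ as k
    ≡⟨ cong (_++ φ (expand ks) ++ as k) (φ-power l (length ks)) ⟨
  φ power ++ φ (expand ks) ++ as k
    ≡⟨ List.++-assoc (φ power) (φ (expand ks)) (as k) ⟨
  (φ power ++ φ (expand ks)) ++ as k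
    ≡⟨ cong (_++ as k) (φ-++ power (expand ks)) ⟨
  φ (power ++ expand ks) ++ as k ∎
  where
  open ≡-Reasoning
  power = concat (replicate l (f (length ks)))

-- Forbidden factors and desubstitution.

φas≢b∷ : ∀ x k {y} → φ x ++ as k ≢ b ∷ y
φas≢b∷ []      zero    ()
φas≢b∷ []      (suc k) ()
φas≢b∷ (a ∷ x) k       ()
φas≢b∷ (b ∷ x) k       ()

-- Each b comes from φ(a) = ab, so an a stands just before it.
φas≢bb : ∀ x k y {z} → φ x ++ as k ≢ y ++ b ∷ b ∷ z
φas≢bb []      zero    []          ()
φas≢bb []      zero    (_ ∷ _)     ()
φas≢bb []      (suc k) []          ()
φas≢bb []      (suc k) (_ ∷ y)     e = φas≢bb [] k y (List.∷-injectiveʳ e)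
φas≢bb (b ∷ x) k       []          ()
φas≢bb (b ∷ x) k       (_ ∷ y)     e = φas≢bb x k y (List.∷-injectiveʳ e)
φas≢bb (a ∷ x) k       []          ()
φas≢bb (a ∷ x) k       (_ ∷ [])    e = φas≢b∷ x k (List.∷-injectiveʳ (List.∷-injectiveʳ e))
φas≢bb (a ∷ x) k       (_ ∷ _ ∷ y) e = φas≢bb x k y (List.∷-injectiveʳ (List.∷-injectiveʳ e))

expand≢bb : ∀ ks y {z} → expand ks ≢ y ++ b ∷ b ∷ z
expand≢bb ks y e with initLast ks
expand≢bb _ []      () | []
expand≢bb _ (_ ∷ _) () | []
... | ks′ ∷ʳ′ k = φas≢bb (expand ks′) k y (trans (sym (expand-∷ʳ ks′ k)) e)

as-or-b : ∀ k x j → as k ≡ φ x ++ as j → ∃[ i ] (x ≡ bs i × k ≡ i + j)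
as-or-b k       []      j e = 0 , refl , trans (sym (List.length-replicate k)) (trans (cong length e) (List.length-replicate j))
as-or-b zero    (a ∷ x) j ()
as-or-b (suc zero)    (a ∷ x) j ()
as-or-b (suc (suc k)) (a ∷ x) j ()
as-or-b zero    (b ∷ x) j ()
as-or-b (suc k) (b ∷ x) j e with i , p , q ← as-or-b k x j (List.∷-injectiveʳ e) = suc i , cong (b ∷_) p , cong suc q

-- φ(x)a^k determines x up to trailing b's, which can be traded for a's.
desubstitute : ∀ x k y j → φ x ++ as k ≡ φ y ++ as j →
  (∃[ i ] (x ≡ y ++ bs i × j ≡ i + k)) ⊎ (∃[ i ] (y ≡ x ++ bs (suc i)))
desubstitute []      k y       j e with as-or-b k y j e
... | zero  , p , q rewrite p = inj₁ (0 , refl , sym q)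
... | suc i , p , q = inj₂ (i , p)
desubstitute (c ∷ x) k []      j e with i , p , q ← as-or-b j (c ∷ x) k (sym e) = inj₁ (i , p , q)
desubstitute (a ∷ x) k (b ∷ y) j e = contradiction (sym (List.∷-injectiveʳ e)) (φas≢b∷ y j)
desubstitute (b ∷ x) k (a ∷ y) j e = contradiction (List.∷-injectiveʳ e) (φas≢b∷ x k)
desubstitute (a ∷ x) k (a ∷ y) j e with desubstitute x k y j (List.∷-injectiveʳ (List.∷-injectiveʳ e))
... | inj₁ (i , p , q) = inj₁ (i , cong (a ∷_) p , q)
... | inj₂ (i , p)     = inj₂ (i , cong (a ∷_) p)
desubstitute (b ∷ x) k (b ∷ y) j e with desubstitute x k y j (List.∷-injectiveʳ e)
... | inj₁ (i , p , q) = inj₁ (i , cong (b ∷_) p , q)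
... | inj₂ (i , p)     = inj₂ (i , cong (b ∷_) p)

bs-∷ʳ : ∀ i → bs (suc i) ≡ bs i ∷ʳ b
bs-∷ʳ zero    = refl
bs-∷ʳ (suc i) = cong (b ∷_) (bs-∷ʳ i)

-- Rules out the second alternative of `desubstitute` for words ending in a, and supplies
-- `NoTrailing-b` for them.
∷ʳa≢++bs : ∀ x y i → x ∷ʳ a ≢ y ++ bs (suc i)
∷ʳa≢++bs x y i e with () ← List.∷ʳ-injectiveʳ x (y ++ bs i)
  (trans e (trans (cong (y ++_) (bs-∷ʳ i)) (sym (List.++-assoc y (bs i) (b ∷ [])))))

-- Factorizations of arbitrary words and their last exponent.

-- The recursion passes through words, such as b, that are not prefixes of the Fibonacci word. At
-- `prefix N` this is `Factorization N` by definition.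
WordFactorization : Word → Set
WordFactorization x = ∃[ ks ] (NoLeadingZero ks × expand ks ≡ x)

wordFactorization-≡ : ∀ {x} {p q : WordFactorization x} → proj₁ p ≡ proj₁ q → p ≡ q
wordFactorization-≡ {p = ks , n , e} {q = _ , n′ , e′} refl =
  cong (ks ,_) (cong₂ _,_ (irrelevant ks n n′) (Decidable⇒UIP.≡-irrelevant (List.≡-dec _≟ᴸ_) e e′))
  where
  irrelevant : ∀ ks (p q : NoLeadingZero ks) → p ≡ q
  irrelevant []           _ _ = refl
  irrelevant (suc k ∷ ks) _ _ = refl

init-noLeadingZero : ∀ ks {k} → NoLeadingZero (ks ∷ʳ k) → NoLeadingZero ks
init-noLeadingZero []       _ = tt
init-noLeadingZero (_ ∷ ks) n = n

-- Exponent 0 appended to the empty list would be a leading zero; `y ≢ []` excludes exactly this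
-- case.
snoc : ∀ {x y} k → φ x ++ as k ≡ y → y ≢ [] → WordFactorization x → WordFactorization y
snoc k e y≢[] (ks , n , refl) =
  ks ∷ʳ k , noLeadingZero ks n (λ e′ → y≢[] (trans (sym e) e′)) , trans (expand-∷ʳ ks k) e
  where
  noLeadingZero : ∀ ks {k} → NoLeadingZero ks → φ (expand ks) ++ as k ≢ [] → NoLeadingZero (ks ∷ʳ k)
  noLeadingZero []       {zero}  _ w≢[] = contradiction refl w≢[]
  noLeadingZero []       {suc k} _ _    = _
  noLeadingZero (_ ∷ ks) n _ = n

snoc-exponents : ∀ {x y} k e (y≢[] : y ≢ []) (p : WordFactorization x) →
  proj₁ (snoc k e y≢[] p) ≡ proj₁ p ∷ʳ k
snoc-exponents k e y≢[] (ks , n , refl) = refl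

snoc-injective : ∀ {x y} k e (y≢[] : y ≢ []) {p q : WordFactorization x} →
  snoc k e y≢[] p ≡ snoc k e y≢[] q → p ≡ q
snoc-injective k e y≢[] {p} {q} eq = wordFactorization-≡ (List.∷ʳ-injectiveˡ _ _
  (trans (sym (snoc-exponents k e y≢[] p)) (trans (cong proj₁ eq) (snoc-exponents k e y≢[] q))))

snoc-disjoint : ∀ {x x′ y} k k′ e e′ (y≢[] : y ≢ []) {p : WordFactorization x} {q : WordFactorization x′} →
  k ≢ k′ → snoc k e y≢[] p ≢ snoc k′ e′ y≢[] q
snoc-disjoint k k′ e e′ y≢[] {p} {q} k≢k′ eq = k≢k′ (List.∷ʳ-injectiveʳ (proj₁ p) (proj₁ q)
  (trans (sym (snoc-exponents k e y≢[] p)) (trans (cong proj₁ eq) (snoc-exponents k′ e′ y≢[] q))))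

-- Inverts `snoc`, but leaves the shortened word as `expand ks`: which word that is will be decided
-- by `desubstitute`.
data Snoc {y} : WordFactorization y → Set where
  view : ∀ ks k (n : NoLeadingZero ks) (e : φ (expand ks) ++ as k ≡ y) {p} →
    proj₁ p ≡ ks ∷ʳ k → Snoc p

snoc-view : ∀ {y} → y ≢ [] → (p : WordFactorization y) → Snoc p
snoc-view y≢[] (ks , n , e) with initLast ks
... | []        = contradiction (sym e) y≢[]
... | ks′ ∷ʳ′ k = view ks′ k (init-noLeadingZero ks′ n) (trans (sym (expand-∷ʳ ks′ k)) e) refl

-- The counting rules for φ(x) and φ(x)a^{j+1}.

Counts : Word → ℕ → Set
Counts x n = Fin n ↔ WordFactorization x

counts-[] : Counts [] 1
counts-[] = mk↔ₛ′ (λ _ → [] , tt , refl) (λ _ → zero)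
  (λ { ([] , _ , _) → wordFactorization-≡ refl ; (suc k ∷ ks , _ , e) → contradiction e (nonempty k ks) })
  λ { zero → refl }
  where
  nonempty : ∀ k ks → expand (suc k ∷ ks) ≢ []
  nonempty k ks e with () ← ℕ.≤-trans (length-f (length ks)) (ℕ.≤-reflexive (cong length
    (List.++-conicalˡ (f (length ks)) _ (List.++-conicalˡ (f (length ks) ++ _) (expand ks) e))))

counts-b : Counts (b ∷ []) 0
counts-b = mk↔ₛ′ (λ ()) (λ p → contradiction p none) (λ p → contradiction p none) λ ()
  where
  none : ¬ WordFactorization (b ∷ [])
  none (ks , _ , e) with initLast ks
  none (_  , _ , ()) | []
  ... | ks′ ∷ʳ′ k = φas≢b∷ (expand ks′) k (trans (sym (expand-∷ʳ ks′ k)) e)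

NoTrailing-b : Word → Set
NoTrailing-b x = ∀ y i → x ≢ y ++ bs (suc i)

-- Here `desubstitute` gives 0 = i + k, so the last exponent k is 0 and appending 0 is onto.
counts-φ : ∀ x {n} → Counts (x ∷ʳ a) n → Counts (φ (x ∷ʳ a)) n
counts-φ x c = ⤖⇒↔ (mk⤖ (snoc-injective 0 e nonempty , surjective)) ↔-∘ c
  where
  e : φ (x ∷ʳ a) ++ as 0 ≡ φ (x ∷ʳ a)
  e = List.++-identityʳ _
  nonempty : φ (x ∷ʳ a) ≢ []
  nonempty eq with () ← List.++-conicalʳ (φ x) _ (trans (sym (φ-++ x (a ∷ []))) eq)
  surjective : ∀ p → ∃[ q ] (∀ {q′} → q′ ≡ q → snoc 0 e nonempty q′ ≡ p)
  surjective p with snoc-view nonempty p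
  ... | view ks k n e₁ e₂ with desubstitute (expand ks) k (x ∷ʳ a) 0 (trans e₁ (sym e))
  ... | inj₂ (i , e₃) = contradiction e₃ (∷ʳa≢++bs x _ i)
  ... | inj₁ (zero , e₃ , refl) = (ks , n , trans e₃ (List.++-identityʳ _)) ,
        λ { {q} refl → wordFactorization-≡ (trans (snoc-exponents 0 e nonempty q) (sym e₂)) }

-- With `expand ks` = x b^i and j + 1 = i + k, the case i = 0 is a factorization of x, i = 1 one of
-- xb, and i ≥ 2 would produce bb. The last exponents j + 1 and j keep the two families disjoint.
counts-φ-as : ∀ x {m n} → NoTrailing-b x → Counts x m → Counts (x ∷ʳ b) n →
  ∀ j → Counts (φ x ++ as (suc j)) (m + n)
counts-φ-as x nb c d j =
  ⤖⇒↔ (mk⤖ ((λ {p} {q} → injective p q) , surjective)) ↔-∘ ((c ⊎-↔ d) ↔-∘ Fin.+↔⊎)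
  where
  e : φ (x ∷ʳ b) ++ as j ≡ φ x ++ as (suc j)
  e = trans (cong (_++ as j) (φ-++ x (b ∷ []))) (List.++-assoc (φ x) (a ∷ []) (as j))
  nonempty : φ x ++ as (suc j) ≢ []
  nonempty eq with () ← List.++-conicalʳ (φ x) _ eq
  extend : WordFactorization x ⊎ WordFactorization (x ∷ʳ b) → WordFactorization (φ x ++ as (suc j))
  extend (inj₁ p) = snoc (suc j) refl nonempty p
  extend (inj₂ p) = snoc j e nonempty p
  injective : ∀ p q → extend p ≡ extend q → p ≡ q
  injective (inj₁ p) (inj₁ q) eq = cong inj₁ (snoc-injective (suc j) refl nonempty eq)
  injective (inj₁ p) (inj₂ q) eq = contradiction eq (snoc-disjoint (suc j) j refl e nonempty ℕ.1+n≢n)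
  injective (inj₂ p) (inj₁ q) eq = contradiction (sym eq) (snoc-disjoint (suc j) j refl e nonempty ℕ.1+n≢n)
  injective (inj₂ p) (inj₂ q) eq = cong inj₂ (snoc-injective j e nonempty eq)
  surjective : ∀ p → ∃[ q ] (∀ {q′} → q′ ≡ q → extend q′ ≡ p)
  surjective p with snoc-view nonempty p
  ... | view ks k n e₁ e₂ with desubstitute (expand ks) k x (suc j) e₁
  ... | inj₂ (i , e₃) = contradiction e₃ (nb _ i)
  ... | inj₁ (zero , e₃ , refl) = inj₁ (ks , n , trans e₃ (List.++-identityʳ _)) ,
        λ { {inj₁ q} refl → wordFactorization-≡ (trans (snoc-exponents (suc j) refl nonempty q) (sym e₂)) }
  ... | inj₁ (suc zero , e₃ , refl) = inj₂ (ks , n , e₃) ,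
        λ { {inj₂ q} refl → wordFactorization-≡ (trans (snoc-exponents j e nonempty q) (sym e₂)) }
  ... | inj₁ (suc (suc i) , e₃ , _) = contradiction e₃ (expand≢bb ks x)

-- The recursion on states.

φ-∷ʳa : ∀ x → φ (x ∷ʳ a) ≡ φ x ∷ʳ a ∷ʳ b
φ-∷ʳa x = trans (φ-++ x (a ∷ [])) (sym (List.++-assoc (φ x) (a ∷ []) (b ∷ [])))

φ-∷ʳb : ∀ x → φ (x ∷ʳ b) ≡ φ x ∷ʳ a
φ-∷ʳb x = φ-++ x (b ∷ [])

∷ʳa-as : ∀ x j → x ∷ʳ a ++ as j ≡ x ++ as (suc j)
∷ʳa-as x j = List.++-assoc x (a ∷ []) (as j)

-- The exponent j is left free because C(φ(y)a^{j+1}) does not depend on it.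
record State (x : Word) (k₀ k₁ k₂ : ℕ) : Set where
  field
    count₀ : Counts (x ∷ʳ a) k₀
    count₁ : ∀ j → Counts (φ x ++ as (suc j)) k₁
    count₂ : ∀ j → Counts (φ (φ x) ++ as (suc j)) k₂

recount : ∀ {x y n} → x ≡ y → Counts x n → Counts y n
recount {n = n} = subst (λ x → Counts x n)

-- Takes over the role of x after two zeros: φ²(xa) is `double x` followed by a.
double : Word → Word
double x = φ (φ x ∷ʳ a)

φφ-∷ʳa : ∀ x → φ (φ (x ∷ʳ a)) ≡ double x ∷ʳ a
φφ-∷ʳa x = trans (cong φ (φ-∷ʳa x)) (φ-∷ʳb (φ x ∷ʳ a))

double-∷ʳb : ∀ x → double x ≡ φ (φ x) ∷ʳ a ∷ʳ b
double-∷ʳb x = φ-∷ʳa (φ x)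

φ-double : ∀ x → φ (double x) ≡ φ (φ (φ x) ∷ʳ a) ∷ʳ a
φ-double x = trans (cong φ (double-∷ʳb x)) (φ-∷ʳb (φ (φ x) ∷ʳ a))

module _ {x k₀ k₁ k₂} (s : State x k₀ k₁ k₂) where
  open State s

  -- The word φ(x)ab is φ(xa), which has as many factorizations as xa.
  counts-double-as : ∀ j → Counts (double x ++ as (suc j)) (k₁ + k₀)
  counts-double-as = counts-φ-as (φ x ∷ʳ a) (∷ʳa≢++bs (φ x)) (count₁ 0)
    (recount (φ-∷ʳa x) (counts-φ x count₀))

  -- The word is φ(φ(x)aa), and φ(x)aa is still counted by `k₁` because the exponent in `count₁` is
  -- free.
  counts-double-ab : Counts (double x ∷ʳ a ∷ʳ b) k₁
  counts-double-ab = recount (φ-∷ʳa (φ x ∷ʳ a))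
    (counts-φ (φ x ∷ʳ a) (recount (sym (∷ʳa-as (φ x) 1)) (count₁ 1)))

  private
    counts-φφφ : ∀ j → Counts (φ (φ (φ x) ∷ʳ a) ++ as (suc j)) (k₂ + k₁)
    counts-φφφ = counts-φ-as (φ (φ x) ∷ʳ a) (∷ʳa≢++bs (φ (φ x))) (count₂ 0)
      (recount (φ-∷ʳa (φ x)) (counts-φ (φ x) (count₁ 0)))

  -- The suffixes of the state names list the digits read from xa on: 00 leads to `double x`
  -- followed by a, 01 to `double x` followed by aa, and 001 to φ(`double x` a)a. Each state belongs
  -- to the word without its last a.
  state-00 : State (double x) (k₁ + k₀) (k₂ + k₁) (k₂ + k₁ + k₂)
  state-00 = record
    { count₀ = counts-double-as 0
    -- φ(`double x`) itself ends in a, which joins a^{j+1}.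
    ; count₁ = λ j → recount (trans (sym (∷ʳa-as _ (suc j))) (cong (_++ as (suc j)) (sym (φ-double x))))
                             (counts-φφφ (suc j))
    ; count₂ = λ j → recount (cong (λ w → φ w ++ as (suc j)) (sym (φ-double x)))
                             (counts-φ-as _ (∷ʳa≢++bs _) (counts-φφφ 0)
                               -- With b appended, the word is φ of φ(φ²(x))-free form φ²(x)aa,
                               -- counted by `count₂ 1`.
                               (recount (φ-∷ʳa _) (counts-φ _ (recount (sym (∷ʳa-as _ 1)) (count₂ 1))))
                               j)
    }

module _ {x k₀ k₁ k₂} (s : State x k₀ k₁ k₂) where

  private
    s⁺ = state-00 s
    module S⁺ = State s⁺

    counts-φ-double-as : ∀ j → Counts (φ (double x ∷ʳ a) ++ as (suc j)) (k₁ + k₀ + k₁)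
    counts-φ-double-as = counts-φ-as _ (∷ʳa≢++bs _) S⁺.count₀ (counts-double-ab s)

  state-01 : State (double x ∷ʳ a) (k₁ + k₀) (k₁ + k₀ + k₁) (k₂ + k₁ + (k₁ + k₀))
  state-01 = record
    { count₀ = recount (sym (∷ʳa-as _ 1)) (counts-double-as s 1)
    ; count₁ = counts-φ-double-as
    ; count₂ = λ j → recount (trans (sym (∷ʳa-as _ (suc j))) (cong (_++ as (suc j)) (sym (φφ-∷ʳa (double x)))))
                             (counts-double-as s⁺ (suc j))
    }

  state-001 : State (φ (double x ∷ʳ a)) (k₁ + k₀ + k₁) (k₂ + k₁ + (k₁ + k₀)) (k₂ + k₁ + (k₁ + k₀) + (k₂ + k₁))
  state-001 = record
    { count₀ = counts-φ-double-as 0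
    ; count₁ = State.count₂ state-01
    ; count₂ = λ j → recount (cong (λ w → φ w ++ as (suc j)) (sym (φφ-∷ʳa (double x))))
                             (counts-φ-as _ (∷ʳa≢++bs _) (counts-double-as s⁺ 0) (counts-double-ab s⁺) j)
    }

-- The leading 1 gives the word a, so x is empty; C(a^{j+1}) = C(ε) + C(b) = 1 + 0.
state-1 : State [] 1 1 1
state-1 = record { count₀ = counts-as 0 ; count₁ = counts-as ; count₂ = counts-as }
  where
  counts-as : ∀ j → Counts (as (suc j)) 1
  counts-as = counts-φ-as [] (λ { [] i () ; (_ ∷ _) i () }) counts-[] counts-b

-- Canonical representations and prefixes of the Fibonacci word.

-- Least significant digit first, like the argument z^R of γ.
w : List Bit → Word
w []             = []
w (zero ∷ r)     = φ (w r)
w (suc zero ∷ r) = φ (w r) ∷ʳ a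

w-expand : ∀ r → w r ≡ expand (digits (reverse r))
w-expand []      = refl
w-expand (d ∷ r) = begin
  w (d ∷ r)                                     ≡⟨ step d ⟩
  φ (w r) ++ as (toℕ d)                         ≡⟨ cong (λ v → φ v ++ as (toℕ d)) (w-expand r) ⟩
  φ (expand (digits (reverse r))) ++ as (toℕ d) ≡⟨ expand-∷ʳ (digits (reverse r)) (toℕ d) ⟨
  expand (digits (reverse r) ∷ʳ toℕ d)          ≡⟨ cong expand (List.map-++ toℕ (reverse r) (d ∷ [])) ⟨
  expand (digits (reverse r ∷ʳ d))              ≡⟨ cong (expand ∘ digits) (List.unfold-reverse d r) ⟨
  expand (digits (reverse (d ∷ r)))             ∎
  where
  open ≡-Reasoning
  step : ∀ d → w (d ∷ r) ≡ φ (w r) ++ as (toℕ d)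
  step zero       = sym (List.++-identityʳ _)
  step (suc zero) = refl

length-f-F : ∀ m → length (f m) ≡ F (m + 2)
length-f-F zero          = refl
length-f-F (suc zero)    = refl
length-f-F (suc (suc m)) = trans (List.length-++ (f (suc m))) (cong₂ _+_ (length-f-F (suc m)) (length-f-F m))

length-power : ∀ k (x : Word) → length (concat (replicate k x)) ≡ k * length x
length-power zero    x = refl
length-power (suc k) x = trans (List.length-++ x) (cong (λ l → length x + l) (length-power k x))

length-expand : ∀ ks → length (expand ks) ≡ [ ks ]F
length-expand []       = refl
length-expand (k ∷ ks) = trans (List.length-++ (concat (replicate k (f (length ks)))))
  (cong₂ _+_ (trans (length-power k (f (length ks))) (cong (k *_) (length-f-F (length ks)))) (length-expand ks))

No11 : List Bit → Set
No11 z = Linked (λ x y → ¬ (x ≡ 1 × y ≡ 1)) (digits z)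

f-suc : ∀ m → ∃[ y ] f (suc m) ≡ f m ++ y
f-suc zero    = f₋₁ , refl
f-suc (suc m) = f m , refl

-- For a leading 0, f_{m+1} begins with f_m. For a leading 10, f_{m+2} = f_{m+1} f_m, and the
-- remaining digits stay inside f_m.
expand-prefix : ∀ z → No11 z → ∃[ y ] f (length z) ≡ expand (digits z) ++ y
expand-prefix []                  l       = _ , refl
expand-prefix (zero ∷ z)          l       with y , e ← expand-prefix z (tail l) | y′ , e′ ← f-suc (length z) =
  y ++ y′ , trans e′ (trans (cong (_++ y′) e) (List.++-assoc (expand (digits z)) y y′))
expand-prefix (suc zero ∷ [])     l       = _ , refl
expand-prefix (suc zero ∷ zero ∷ z) (_ ∷ l) with y , e ← expand-prefix z (tail l) =
  y , (begin
  x ++ f (length z)               ≡⟨ cong (x ++_) e ⟩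
  x ++ expand (digits z) ++ y     ≡⟨ List.++-assoc x (expand (digits z)) y ⟨
  (x ++ expand (digits z)) ++ y   ≡⟨ cong (λ v → (v ++ expand (digits z)) ++ y) x≡ ⟩
  expand (digits (suc zero ∷ zero ∷ z)) ++ y ∎)
  where
  open ≡-Reasoning
  x = f (suc (length z))
  x≡ : x ≡ f (suc (length (digits z))) ++ []
  x≡ = trans (cong (f ∘ suc) (sym (List.length-map toℕ z))) (sym (List.++-identityʳ _))
expand-prefix (suc zero ∷ suc zero ∷ z) (p ∷ l) = contradiction (refl , refl) p

take-length-++ : ∀ (x y : Word) → take (length x) (x ++ y) ≡ x
take-length-++ []      y = refl
take-length-++ (c ∷ x) y = cong (c ∷_) (take-length-++ x y)

expand-canonical : ∀ {n z} → IsCanonical n z → expand (digits z) ≡ prefix n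
expand-canonical {n} {z} c with y , e ← expand-prefix z (IsCanonical.noConsecutive1s c) = begin
  x                     ≡⟨ take-length-++ x y ⟨
  take (length x) (x ++ y) ≡⟨ cong₂ take length-x (sym e) ⟩
  take n (f (length z)) ≡⟨ prefix-of-f n (length z) n≤ ⟩
  prefix n              ∎
  where
  open ≡-Reasoning
  x = expand (digits z)
  length-x : length x ≡ n
  length-x = trans (length-expand (digits z)) (IsCanonical.value c)
  n≤ : n ≤ length (f (length z))
  n≤ = subst (_≤ length (f (length z))) length-x
    (ℕ.≤-trans (ℕ.m≤m+n _ _) (ℕ.≤-reflexive (sym (trans (cong length e) (List.length-++ x)))))

-- Matrices acting on column vectors, and reversal by transposition.

infixr 7 _▹_

_▹_ : ∀ {m n} → Matrix m n → Vector ℤ n → Vector ℤ m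
_▹_ {n = n} M v i = ∑[ j < n ] (M i j ℤ.* v j)

infix 8 _∙_

_∙_ : ∀ {n} → Vector ℤ n → Vector ℤ n → ℤ
_∙_ {n} v w = ∑[ i < n ] (v i ℤ.* w i)

∙-comm : ∀ {n} (v w : Vector ℤ n) → v ∙ w ≡ w ∙ v
∙-comm v w = sum-cong-≗ λ i → ℤ.*-comm (v i) (w i)

∙-congˡ : ∀ {n} (v : Vector ℤ n) {w w′} → w ≗ w′ → v ∙ w ≡ v ∙ w′
∙-congˡ v e = sum-cong-≗ λ i → cong (v i ℤ.*_) (e i)

∙-congʳ : ∀ {n} {v v′} (w : Vector ℤ n) → v ≗ v′ → v ∙ w ≡ v′ ∙ w
∙-congʳ w e = sum-cong-≗ λ i → cong (ℤ._* w i) (e i)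

▹-congˡ : ∀ {m n} (M : Matrix m n) {v v′} → v ≗ v′ → M ▹ v ≗ M ▹ v′
▹-congˡ M e i = ∙-congˡ (M i) e

-- Rebrackets (vM)w as v(Mw), so that γ can act on u one letter at a time.
∙-▹ : ∀ {m n} v (M : Matrix m n) w → v ⟨ M ⟩ w ≡ v ∙ (M ▹ w)
∙-▹ {m} {n} v M w = begin
  ∑[ j < n ] ((∑[ i < m ] (v i ℤ.* M i j)) ℤ.* w j) ≡⟨ sum-cong-≗ (λ j → *-distribʳ-sum (w j) (λ i → v i ℤ.* M i j)) ⟩
  ∑[ j < n ] ∑[ i < m ] (v i ℤ.* M i j ℤ.* w j)     ≡⟨ ∑-comm (λ j i → v i ℤ.* M i j ℤ.* w j) ⟩
  ∑[ i < m ] ∑[ j < n ] (v i ℤ.* M i j ℤ.* w j)     ≡⟨ sum-cong-≗ (λ i → sum-cong-≗ λ j → ℤ.*-assoc (v i) (M i j) (w j)) ⟩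
  ∑[ i < m ] ∑[ j < n ] (v i ℤ.* (M i j ℤ.* w j))   ≡⟨ sum-cong-≗ (λ i → *-distribˡ-sum (v i) (λ j → M i j ℤ.* w j)) ⟨
  v ∙ (M ▹ w) ∎
  where open ≡-Reasoning

▹-· : ∀ {l m n} (A : Matrix l m) (B : Matrix m n) v → (A · B) ▹ v ≗ A ▹ B ▹ v
▹-· A B v i = ∙-▹ (A i) B v

identity-suc : ∀ {n} (i j : Fin n) → identity (suc i) (suc j) ≡ identity i j
identity-suc i j with i Fin.≟ j
... | yes _ = refl
... | no  _ = refl

sum-zero : ∀ {n} (v : Vector ℤ n) → ∑[ i < n ] (0ℤ ℤ.* v i) ≡ 0ℤ
sum-zero {n} v = sum-replicate-zero n

identity-▹ : ∀ {n} (v : Vector ℤ n) → identity ▹ v ≗ v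
identity-▹ v zero    = trans (cong₂ ℤ._+_ (ℤ.*-identityˡ (v zero)) (sum-zero (v ∘ suc))) (ℤ.+-identityʳ _)
identity-▹ v (suc i) = trans (ℤ.+-identityˡ _)
  (trans (∙-congʳ (v ∘ suc) (identity-suc i)) (identity-▹ (v ∘ suc) i))

t-∙ : ∀ v → t ∙ v ≡ v zero
t-∙ v = identity-▹ v zero

orbit : List Bit → Vector ℤ 8
orbit []      = u
orbit (d ∷ r) = γ-letter d ▹ orbit r

γ-▹-u : ∀ r → γ r ▹ u ≗ orbit r
γ-▹-u []      = identity-▹ u
γ-▹-u (d ∷ r) i = trans (▹-· (γ-letter d) (γ r) u i) (▹-congˡ (γ-letter d) (γ-▹-u r) i)

-- Regularity reads z from its most significant digit, γ from its least. Transposition reverses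
-- products, so u becomes the row vector and t the column vector.
γᵀ-letter : Bit → Matrix 8 8
γᵀ-letter d i j = γ-letter d j i

-- The induction needs r, the digits already read, in reversed order.
orbit-morphism : ∀ z r → orbit r ⟨ morphism γᵀ-letter z ⟩ t ≡ orbit (z ʳ++ r) zero
orbit-morphism []      r = begin
  orbit r ⟨ identity ⟩ t ≡⟨ ∙-▹ (orbit r) identity t ⟩
  orbit r ∙ (identity ▹ t) ≡⟨ ∙-congˡ (orbit r) (identity-▹ t) ⟩
  orbit r ∙ t            ≡⟨ ∙-comm (orbit r) t ⟩
  t ∙ orbit r            ≡⟨ t-∙ (orbit r) ⟩
  orbit r zero           ∎
  where open ≡-Reasoning
orbit-morphism (d ∷ z) r = begin
  orbit r ⟨ γᵀ-letter d · M ⟩ t           ≡⟨ ∙-▹ (orbit r) (γᵀ-letter d · M) t ⟩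
  orbit r ∙ ((γᵀ-letter d · M) ▹ t)       ≡⟨ ∙-congˡ (orbit r) (▹-· (γᵀ-letter d) M t) ⟩
  orbit r ∙ (γᵀ-letter d ▹ M ▹ t)         ≡⟨ ∙-▹ (orbit r) (γᵀ-letter d) (M ▹ t) ⟨
  orbit r ⟨ γᵀ-letter d ⟩ (M ▹ t)         ≡⟨ ∙-congʳ (M ▹ t) (λ j → ∙-comm (orbit r) (γ-letter d j)) ⟩
  orbit (d ∷ r) ∙ (M ▹ t)                 ≡⟨ ∙-▹ (orbit (d ∷ r)) M t ⟨
  orbit (d ∷ r) ⟨ M ⟩ t                   ≡⟨ orbit-morphism z (d ∷ r) ⟩
  orbit (z ʳ++ (d ∷ r)) zero              ∎
  where
  open ≡-Reasoning
  M = morphism γᵀ-letter z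

-- The eight coordinates as linear functions of a state.

triple : ℕ → ℕ → ℕ → Vector ℤ 3
triple k l m = + k ∷ᵛ + l ∷ᵛ + m ∷ᵛ []ᵛ

matrix : ∀ {m n} → Vec (Vec ℕ n) m → Matrix m n
matrix rows i j = + Vec.lookup (Vec.lookup rows i) j

-- The eight coordinates of γ(z^R)u are V([zy]_F) for y = ε, 0, 1, 00, 000, 100, 0000,
-- 10000, or 0 if zy contains 11. The rows below express them in terms of a State,
-- according to whether z ends in 1, in an odd or in a positive even number of zeros; in
-- the even case the State is the one two digits earlier.
X₁ X₁₀ X₁₀₀ : Matrix 8 3
X₁ = matrix
  ( (1 ∷ 0 ∷ 0 ∷ [])
  ∷ (1 ∷ 0 ∷ 0 ∷ [])
  ∷ (0 ∷ 0 ∷ 0 ∷ [])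
  ∷ (1 ∷ 1 ∷ 0 ∷ [])
  ∷ (1 ∷ 1 ∷ 0 ∷ [])
  ∷ (0 ∷ 0 ∷ 0 ∷ [])
  ∷ (1 ∷ 2 ∷ 1 ∷ [])
  ∷ (0 ∷ 0 ∷ 0 ∷ [])
  ∷ [] )
X₁₀ = matrix
  ( (1 ∷ 0 ∷ 0 ∷ [])
  ∷ (1 ∷ 1 ∷ 0 ∷ [])
  ∷ (1 ∷ 1 ∷ 0 ∷ [])
  ∷ (1 ∷ 1 ∷ 0 ∷ [])
  ∷ (1 ∷ 2 ∷ 1 ∷ [])
  ∷ (2 ∷ 3 ∷ 0 ∷ [])
  ∷ (1 ∷ 2 ∷ 1 ∷ [])
  ∷ (4 ∷ 7 ∷ 1 ∷ [])
  ∷ [] )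
X₁₀₀ = matrix
  ( (1 ∷ 1 ∷ 0 ∷ [])
  ∷ (1 ∷ 1 ∷ 0 ∷ [])
  ∷ (1 ∷ 2 ∷ 0 ∷ [])
  ∷ (1 ∷ 2 ∷ 1 ∷ [])
  ∷ (1 ∷ 2 ∷ 1 ∷ [])
  ∷ (2 ∷ 4 ∷ 1 ∷ [])
  ∷ (1 ∷ 4 ∷ 4 ∷ [])
  ∷ (4 ∷ 9 ∷ 4 ∷ [])
  ∷ [] )

-- The actions of `state-00`, `state-01` and `state-001` on the three counts.
S₀₀ S₀₁ S₀₀₁ : Matrix 3 3
S₀₀ = matrix
  ( (1 ∷ 1 ∷ 0 ∷ [])
  ∷ (0 ∷ 1 ∷ 1 ∷ [])
  ∷ (0 ∷ 1 ∷ 2 ∷ [])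
  ∷ [] )
S₀₁ = matrix
  ( (1 ∷ 1 ∷ 0 ∷ [])
  ∷ (1 ∷ 2 ∷ 0 ∷ [])
  ∷ (1 ∷ 2 ∷ 1 ∷ [])
  ∷ [] )
S₀₀₁ = matrix
  ( (1 ∷ 2 ∷ 0 ∷ [])
  ∷ (1 ∷ 2 ∷ 1 ∷ [])
  ∷ (1 ∷ 3 ∷ 2 ∷ [])
  ∷ [] )

infix 4 _≈_ _≈?_

_≈_ : ∀ {m n} → Matrix m n → Matrix m n → Set
A ≈ B = ∀ i j → A i j ≡ B i j

_≈?_ : ∀ {m n} (A B : Matrix m n) → Dec (A ≈ B)
A ≈? B = Fin.all? λ i → Fin.all? λ j → A i j ℤ.≟ B i j

-- This and the next four identities are decided entry by entry. A factor S appears exactly when the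
-- stored state is replaced.
γ₀-X₁ : γ-letter zero · X₁ ≈ X₁₀
γ₀-X₁ = from-yes (γ-letter zero · X₁ ≈? X₁₀)

γ₀-X₁₀ : γ-letter zero · X₁₀ ≈ X₁₀₀
γ₀-X₁₀ = from-yes (γ-letter zero · X₁₀ ≈? X₁₀₀)

γ₁-X₁₀ : γ-letter (suc zero) · X₁₀ ≈ X₁ · S₀₁
γ₁-X₁₀ = from-yes (γ-letter (suc zero) · X₁₀ ≈? X₁ · S₀₁)

γ₀-X₁₀₀ : γ-letter zero · X₁₀₀ ≈ X₁₀ · S₀₀
γ₀-X₁₀₀ = from-yes (γ-letter zero · X₁₀₀ ≈? X₁₀ · S₀₀)

γ₁-X₁₀₀ : γ-letter (suc zero) · X₁₀₀ ≈ X₁ · S₀₀₁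
γ₁-X₁₀₀ = from-yes (γ-letter (suc zero) · X₁₀₀ ≈? X₁ · S₀₀₁)

γ₀-u : γ-letter zero ▹ u ≗ u
γ₀-u = from-yes (Fin.all? λ i → (γ-letter zero ▹ u) i ℤ.≟ u i)

γ₁-u : γ-letter (suc zero) ▹ u ≗ X₁ ▹ triple 1 1 1
γ₁-u = from-yes (Fin.all? λ i → (γ-letter (suc zero) ▹ u) i ℤ.≟ (X₁ ▹ triple 1 1 1) i)

orbit-step : ∀ {n} d r (X Y : Matrix 8 n) (v : Vector ℤ n) →
  γ-letter d · X ≈ Y → orbit r ≗ X ▹ v → orbit (d ∷ r) ≗ Y ▹ v
orbit-step d r X Y v γX≈Y e i = begin
  (γ-letter d ▹ orbit r) i ≡⟨ ▹-congˡ (γ-letter d) e i ⟩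
  (γ-letter d ▹ X ▹ v) i   ≡⟨ ▹-· (γ-letter d) X v i ⟨
  ((γ-letter d · X) ▹ v) i ≡⟨ ∙-congʳ v (γX≈Y i) ⟩
  (Y ▹ v) i                ∎
  where open ≡-Reasoning

-- The invariant kept while digits are read.

-- One state governs both the word and the vector; once a 1 has been read, its xa is the word none,
-- one or two digits back.
data Reached : List Bit → Set where
  zeros  : ∀ {r} → w r ≡ [] → orbit r ≗ u → Reached r
  after1 : ∀ {r x k l m} → State x k l m → w (suc zero ∷ r) ≡ x ∷ʳ a →
           orbit (suc zero ∷ r) ≗ X₁ ▹ triple k l m → Reached (suc zero ∷ r)
  odd    : ∀ {r x k l m} → State x k l m → w r ≡ φ (x ∷ʳ a) →
           orbit r ≗ X₁₀ ▹ triple k l m → Reached r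
  even   : ∀ {r x k l m} → State x k l m → w r ≡ φ (φ (x ∷ʳ a)) →
           orbit r ≗ X₁₀₀ ▹ triple k l m → Reached r

S₀₀-▹ : ∀ k l m → S₀₀ ▹ triple k l m ≗ triple (l + k) (m + l) (m + l + m)
S₀₀-▹ k l m zero = p (+ k) (+ l) (+ m) where
  p : ∀ k l m → 1ℤ ℤ.* k ℤ.+ (1ℤ ℤ.* l ℤ.+ (0ℤ ℤ.* m ℤ.+ 0ℤ)) ≡ l ℤ.+ k
  p = solve-∀
S₀₀-▹ k l m (suc zero) = p (+ k) (+ l) (+ m) where
  p : ∀ k l m → 0ℤ ℤ.* k ℤ.+ (1ℤ ℤ.* l ℤ.+ (1ℤ ℤ.* m ℤ.+ 0ℤ)) ≡ m ℤ.+ l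
  p = solve-∀
S₀₀-▹ k l m (suc (suc zero)) = p (+ k) (+ l) (+ m) where
  p : ∀ k l m → 0ℤ ℤ.* k ℤ.+ (1ℤ ℤ.* l ℤ.+ (+ 2 ℤ.* m ℤ.+ 0ℤ)) ≡ m ℤ.+ l ℤ.+ m
  p = solve-∀

S₀₁-▹ : ∀ k l m → S₀₁ ▹ triple k l m ≗ triple (l + k) (l + k + l) (m + l + (l + k))
S₀₁-▹ k l m zero = p (+ k) (+ l) (+ m) where
  p : ∀ k l m → 1ℤ ℤ.* k ℤ.+ (1ℤ ℤ.* l ℤ.+ (0ℤ ℤ.* m ℤ.+ 0ℤ)) ≡ l ℤ.+ k
  p = solve-∀
S₀₁-▹ k l m (suc zero) = p (+ k) (+ l) (+ m) where
  p : ∀ k l m → 1ℤ ℤ.* k ℤ.+ (+ 2 ℤ.* l ℤ.+ (0ℤ ℤ.* m ℤ.+ 0ℤ)) ≡ l ℤ.+ k ℤ.+ l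
  p = solve-∀
S₀₁-▹ k l m (suc (suc zero)) = p (+ k) (+ l) (+ m) where
  p : ∀ k l m → 1ℤ ℤ.* k ℤ.+ (+ 2 ℤ.* l ℤ.+ (1ℤ ℤ.* m ℤ.+ 0ℤ)) ≡ m ℤ.+ l ℤ.+ (l ℤ.+ k)
  p = solve-∀

S₀₀₁-▹ : ∀ k l m → S₀₀₁ ▹ triple k l m ≗ triple (l + k + l) (m + l + (l + k)) (m + l + (l + k) + (m + l))
S₀₀₁-▹ k l m zero = p (+ k) (+ l) (+ m) where
  p : ∀ k l m → 1ℤ ℤ.* k ℤ.+ (+ 2 ℤ.* l ℤ.+ (0ℤ ℤ.* m ℤ.+ 0ℤ)) ≡ l ℤ.+ k ℤ.+ l
  p = solve-∀
S₀₀₁-▹ k l m (suc zero) = p (+ k) (+ l) (+ m) where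
  p : ∀ k l m → 1ℤ ℤ.* k ℤ.+ (+ 2 ℤ.* l ℤ.+ (1ℤ ℤ.* m ℤ.+ 0ℤ)) ≡ m ℤ.+ l ℤ.+ (l ℤ.+ k)
  p = solve-∀
S₀₀₁-▹ k l m (suc (suc zero)) = p (+ k) (+ l) (+ m) where
  p : ∀ k l m → 1ℤ ℤ.* k ℤ.+ (+ 3 ℤ.* l ℤ.+ (+ 2 ℤ.* m ℤ.+ 0ℤ)) ≡ m ℤ.+ l ℤ.+ (l ℤ.+ k) ℤ.+ (m ℤ.+ l)
  p = solve-∀

orbit-step-state : ∀ d r (X Y : Matrix 8 3) (S : Matrix 3 3) v {v′} →
  γ-letter d · X ≈ Y · S → S ▹ v ≗ v′ → orbit r ≗ X ▹ v → orbit (d ∷ r) ≗ Y ▹ v′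
orbit-step-state d r X Y S v γX≈YS Sv≗v′ e i =
  trans (orbit-step d r X (Y · S) v γX≈YS e i) (trans (▹-· Y S v i) (▹-congˡ Y Sv≗v′ i))

reached-0 : ∀ r → Reached r → Reached (zero ∷ r)
reached-0 r (zeros e o) =
  zeros (cong φ e) (λ i → trans (▹-congˡ (γ-letter zero) o i) (γ₀-u i))
reached-0 r (after1 {k = k} {l} {m} s e o) =
  odd s (cong φ e) (orbit-step zero r X₁ X₁₀ (triple k l m) γ₀-X₁ o)
reached-0 r (odd {k = k} {l} {m} s e o) =
  even s (cong φ e) (orbit-step zero r X₁₀ X₁₀₀ (triple k l m) γ₀-X₁₀ o)
reached-0 r (even {x = x} {k} {l} {m} s e o) =
  odd (state-00 s) (cong φ (trans e (φφ-∷ʳa x)))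
    (orbit-step-state zero r X₁₀₀ X₁₀ S₀₀ (triple k l m) γ₀-X₁₀₀ (S₀₀-▹ k l m) o)

-- The head is the digit read last; reading 1 from `after1` would create 11.
data Ends1 : List Bit → Set where
  ends1 : ∀ {r} → Ends1 (suc zero ∷ r)

reached-1 : ∀ r → ¬ Ends1 r → Reached r → Reached (suc zero ∷ r)
reached-1 r _ (zeros e o) = after1 state-1 (cong (λ x → φ x ∷ʳ a) e)
  (λ i → trans (▹-congˡ (γ-letter (suc zero)) o i) (γ₁-u i))
reached-1 _ n (after1 s e o) = contradiction ends1 n
reached-1 r _ (odd {x = x} {k} {l} {m} s e o) =
  after1 (state-01 s) (cong (_∷ʳ a) (trans (cong φ e) (φφ-∷ʳa x)))
    (orbit-step-state (suc zero) r X₁₀ X₁ S₀₁ (triple k l m) γ₁-X₁₀ (S₀₁-▹ k l m) o)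
reached-1 r _ (even {x = x} {k} {l} {m} s e o) =
  after1 (state-001 s) (cong (λ y → φ y ∷ʳ a) (trans e (φφ-∷ʳa x)))
    (orbit-step-state (suc zero) r X₁₀₀ X₁ S₀₀₁ (triple k l m) γ₁-X₁₀₀ (S₀₀₁-▹ k l m) o)

-- Keeping the last digit d visible makes the absence of 11 available where z begins.
reached-ʳ++ : ∀ d z {r} → Reached (d ∷ r) → No11 (d ∷ z) → Reached (z ʳ++ (d ∷ r))
reached-ʳ++ d          []             R l       = R
reached-ʳ++ d          (zero ∷ z)     R (p ∷ l) = reached-ʳ++ zero z (reached-0 _ R) l
reached-ʳ++ zero       (suc zero ∷ z) R (p ∷ l) = reached-ʳ++ (suc zero) z (reached-1 _ (λ ()) R) l
reached-ʳ++ (suc zero) (suc zero ∷ z) R (p ∷ l) = contradiction (refl , refl) p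

reached-[] : Reached []
reached-[] = zeros refl λ _ → refl

reached : ∀ z → No11 z → Reached (reverse z)
reached []             l = reached-[]
reached (zero ∷ z)     l = reached-ʳ++ zero z (reached-0 _ reached-[]) l
reached (suc zero ∷ z) l = reached-ʳ++ (suc zero) z (reached-1 _ (λ ()) reached-[]) l

-- Only first rows matter: those of `X₁` and `X₁₀` agree with the identity, that of `X₁₀₀` with
-- `S₀₀`.
reached-counts : ∀ {r} → Reached r → ∃[ n ] (Counts (w r) n × orbit r zero ≡ + n)
reached-counts (zeros e o) = 1 , recount (sym e) counts-[] , o zero
reached-counts (after1 {k = k} {l} {m} s e o) =
  k , recount (sym e) (State.count₀ s) , trans (o zero) (identity-▹ (triple k l m) zero)
reached-counts (odd {x = x} {k} {l} {m} s e o) =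
  k , recount (sym e) (counts-φ x (State.count₀ s)) , trans (o zero) (identity-▹ (triple k l m) zero)
reached-counts (even {x = x} {k} {l} {m} s e o) =
  l + k , recount (sym (trans e (φφ-∷ʳa x))) (State.count₀ (state-00 s)) , trans (o zero) (S₀₀-▹ k l m zero)

orbit-V : ∀ n z → IsCanonical n z → orbit (reverse z) zero ≡ + V n
orbit-V n z c with m , C , o ← reached-counts (reached z (IsCanonical.noConsecutive1s c)) =
  -- `Fin m` and `Fin (V n)` are both in bijection with the factorizations of `prefix n`, so m =
  -- V(n).
  trans o (cong +_ (Permutation.↔⇒≡ (↔-sym (V-counts n) ↔-∘ recount w≡ C)))
  where
  w≡ : w (reverse z) ≡ prefix n
  w≡ = trans (w-expand (reverse z)) (trans (cong (expand ∘ digits) (List.reverse-involutive z)) (expand-canonical c))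

theorem2 : (∀ n z → IsCanonical n z → t ⟨ γ (reverse z) ⟩ u ≡ + V n)
    × FibonacciRegular (λ n → + V n)
theorem2 = γ-V , 8 , u , γᵀ-letter , t , λ n z c → sym (trans (orbit-morphism z []) (orbit-V n z c))
  where
  γ-V : ∀ n z → IsCanonical n z → t ⟨ γ (reverse z) ⟩ u ≡ + V n
  γ-V n z c = begin
    t ⟨ γ (reverse z) ⟩ u       ≡⟨ ∙-▹ t (γ (reverse z)) u ⟩
    t ∙ (γ (reverse z) ▹ u)     ≡⟨ ∙-congˡ t (γ-▹-u (reverse z)) ⟩
    t ∙ orbit (reverse z)       ≡⟨ t-∙ (orbit (reverse z)) ⟩
    orbit (reverse z) zero      ≡⟨ orbit-V n z c ⟩
    + V n                       ∎
    where open ≡-Reasoning
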